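{- For any irrational number $x\in(0,1)$ and any integer $n\ge1$, $$L_n(x,\mathcal{CF},\mathcal F)=2q_n(x)+q_{n-1}(x)-2.$$
   Context: $\mathbb N$ includes $0$. For an irrational $x\in(0,1)$ with continued fraction expansion $x=[0;a_1,a_2,\dots]$, set $p_{ -1}=1,p_0=0,q_{ -1}=0,q_0=1$, $p_n=a_np_{n-1}+p_{n-2}$, $q_n=q_n(x)=a_nq_{n-1}+q_{n-2}$. $\mathcal{CF}$ is the continued fraction sequence of partitions of $[0,1]$ into open intervals: its depth-$0$ partition is $\{(0,1)\}$, and its depth-$n$ interval containing the irrational $x$ ($n\ge1$) is the open interval $I_n^{\mathcal{CF}}(x)$ with endpoints $\frac{p_n}{q_n}$ and $\frac{p_n+p_{n-1}}{q_n+q_{n-1}}$. $\mathcal F=\{F_n\}_{n\in\mathbb N}$ is the Farey sequence of partitions: $F_n$ consists of the open intervals between consecutive elements of $\{p/q:0\le p\le q\le n+1,\ q\ge1,\ \gcd(p,q)=1\}$, and $I_n^{\mathcal F}(x)$ is the interval of $F_n$ containing $x$. The Lochs index is $L_n(x,\mathcal{CF},\mathcal F)=\sup\{\ell\in\mathbb N: I_n^{\mathcal{CF}}(x)\subseteq I_\ell^{\mathcal F}(x)\}$. -}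

module Defs where

open import Data.Integer.Base using (+_)
open import Data.Nat.Base as ℕ using (ℕ; zero; suc; NonZero)
import Data.Nat.Properties as ℕ
open import Data.Nat.GCD using (gcd)
open import Data.Product.Base using (∃; ∃-syntax; Σ-syntax; _×_; _,_)
open import Data.Rational.Base
  using (ℚ; 0ℚ; 1ℚ; _/_; -_; _+_; _-_; _<_; _⊓_; _⊔_)
import Data.Rational.Properties as ℚ
open import Data.Sum.Base using (_⊎_; inj₁; inj₂)
open import Function.Bundles using (_⇔_; mk⇔)
open import Level using (Level; 0ℓ)
open import Relation.Binary.Definitions using (tri<; tri≈; tri>)
open import Relation.Binary.PropositionalEquality using (_≡_; refl; subst)
open import Relation.Nullary.Negation using (¬_)
open import Relation.Unary using (Pred; _∈_; _⊆_)

-- Real numbers as two-sided Dedekind cuts: `lower x r` means r < x and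
-- `upper x r` means x < r.  Equality of reals is `_≃_`, not `_≡_`.
record ℝ : Set₁ where
  field
    lower upper     : Pred ℚ 0ℓ
    lower-inhabited : ∃ lower
    upper-inhabited : ∃ upper
    lower-rounded   : ∀ r → lower r ⇔ (∃[ s ] r < s × lower s)
    upper-rounded   : ∀ r → upper r ⇔ (∃[ s ] s < r × upper s)
    disjoint        : ∀ r → ¬ (lower r × upper r)
    located         : ∀ {r s} → r < s → lower r ⊎ upper s

open ℝ public

infix 4 _≃_

_≃_ : ℝ → ℝ → Set
x ≃ y = ∀ r → (lower x r ⇔ lower y r) × (upper x r ⇔ upper y r)

fromℚ : ℚ → ℝ
fromℚ t = record
  { lower           = _< t
  ; upper           = t <_
  ; lower-inhabited = t - 1ℚ , t-1<t
  ; upper-inhabited = t + 1ℚ , t<t+1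
  ; lower-rounded   = λ r → mk⇔ ℚ.<-dense (λ (s , r<s , s<t) → ℚ.<-trans r<s s<t)
  ; upper-rounded   = λ r → mk⇔ (λ t<r → let s , t<s , s<r = ℚ.<-dense t<r in s , s<r , t<s)
                                (λ (s , s<r , t<s) → ℚ.<-trans t<s s<r)
  ; disjoint        = λ r (r<t , t<r) → ℚ.<-asym r<t t<r
  ; located         = splits
  }
  where
  t-1<t : t - 1ℚ < t
  t-1<t = subst (t - 1ℚ <_) (ℚ.+-identityʳ t) (ℚ.+-monoʳ-< t (ℚ.negative⁻¹ (- 1ℚ)))

  t<t+1 : t < t + 1ℚ
  t<t+1 = subst (_< t + 1ℚ) (ℚ.+-identityʳ t) (ℚ.+-monoʳ-< t (ℚ.positive⁻¹ 1ℚ))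

  splits : ∀ {r s} → r < s → (r < t) ⊎ (t < s)
  splits {r} r<s with ℚ.<-cmp r t
  ... | tri< r<t _    _   = inj₁ r<t
  ... | tri≈ _   refl _   = inj₂ r<s
  ... | tri> _   _    t<r = inj₂ (ℚ.<-trans t<r r<s)

Irrational : Pred ℝ 0ℓ
Irrational x = ∀ r → ¬ (x ≃ fromℚ r)

⟨_,_⟩ : ℚ → ℚ → Pred ℝ 0ℓ
⟨ r , s ⟩ y = lower y r × upper y s

-- `term a n` is a_n for n ≥ 1; `term a 0` is never used.
record PartialQuotients : Set where
  field
    term     : ℕ → ℕ
    positive : ∀ n → NonZero (term (suc n))

open PartialQuotients public

module _ (a : PartialQuotients) where

  -- `pPrev n` is p_{n-1} and `qPrev n` is q_{n-1}, including the index -1.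
  p pPrev q qPrev : ℕ → ℕ

  p zero    = 0
  p (suc n) = term a (suc n) ℕ.* p n ℕ.+ pPrev n

  pPrev zero    = 1
  pPrev (suc n) = p n

  q zero    = 1
  q (suc n) = term a (suc n) ℕ.* q n ℕ.+ qPrev n

  qPrev zero    = 0
  qPrev (suc n) = q n

  q>0 : ∀ n → 0 ℕ.< q n
  q>0 zero    = ℕ.≤-refl
  q>0 (suc n) = ℕ.<-≤-trans
    (ℕ.*-mono-≤ (ℕ.>-nonZero⁻¹ _ {{positive a n}}) (q>0 n))
    (ℕ.m≤m+n _ (qPrev n))

  q-nonZero : ∀ n → NonZero (q n)
  q-nonZero n = ℕ.>-nonZero (q>0 n)

  q+qPrev-nonZero : ∀ n → NonZero (q n ℕ.+ qPrev n)
  q+qPrev-nonZero n = ℕ.>-nonZero (ℕ.<-≤-trans (q>0 n) (ℕ.m≤m+n _ (qPrev n)))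

  convergent : ℕ → ℚ
  convergent n = _/_ (+ p n) (q n) {{q-nonZero n}}

  mediant : ℕ → ℚ
  mediant n = _/_ (+ (p n ℕ.+ pPrev n)) (q n ℕ.+ qPrev n) {{q+qPrev-nonZero n}}

  -- Which of the two endpoints is the smaller depends on the parity of n.
  cfCell : ℕ → Pred ℝ 0ℓ
  cfCell n = ⟨ convergent n ⊓ mediant n , convergent n ⊔ mediant n ⟩

infix 4 _≐[0⸴_]

-- x = [0; a₁, a₂, …]: the convergents p_n/q_n tend to x.
_≐[0⸴_] : ℝ → PartialQuotients → Set
x ≐[0⸴ a ] = ∀ ε → 0ℚ < ε → ∃[ N ] ∀ n → N ℕ.≤ n →
  x ∈ ⟨ convergent a n - ε , convergent a n + ε ⟩

FareyFraction : ℕ → Pred ℚ 0ℓ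
FareyFraction n r = ∃[ u ] ∃[ v ] Σ[ v≢0 ∈ NonZero v ]
  u ℕ.≤ v × v ℕ.≤ n ℕ.+ 1 × gcd u v ≡ 1 × r ≡ _/_ (+ u) v {{v≢0}}

Consecutive : Pred ℚ 0ℓ → ℚ → ℚ → Set
Consecutive S r s = r ∈ S × s ∈ S × r < s × (∀ t → t ∈ S → ¬ (r < t × t < s))

-- The interval of F_n containing x, as a set of reals: y belongs to it when
-- some interval of F_n contains both x and y.
fareyCell : ℕ → ℝ → Pred ℝ 0ℓ
fareyCell n x y = ∃[ r ] ∃[ s ]
  Consecutive (FareyFraction n) r s × x ∈ ⟨ r , s ⟩ × y ∈ ⟨ r , s ⟩

IsSup : ∀ {ℓ : Level} → Pred ℕ ℓ → ℕ → Set ℓ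
IsSup S N = (∀ k → k ∈ S → k ℕ.≤ N) × (∀ M → (∀ k → k ∈ S → k ℕ.≤ M) → N ℕ.≤ M)

-- L_n = N, for I and J the cells around a fixed point x in the two sequences
-- of partitions.  A finite N is the supremum in ℕ ∪ {∞} exactly when it is the
-- least upper bound in ℕ.
IsLochsIndex : (I J : ℕ → Pred ℝ 0ℓ) → ℕ → ℕ → Set₁
IsLochsIndex I J n N = IsSup (λ k → I n ⊆ J k) N

{-# OPTIONS --safe #-}

-- The endpoints a/b < c/d of a continued fraction cell satisfy cb − ad = 1.  Hence
-- every fraction strictly between them has denominator at least b + d, a value which
-- their mediant (a + c)/(b + d) attains.  So the cell is itself an interval of F_k for
-- k + 2 = b + d, while for larger k the mediant splits it; and b + d = 2q_n + q_{n-1}.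
-- That x lies strictly inside the cell follows from the convergence of the convergents:
-- each step from (c_n, m_n), convergent and mediant, to (c_{n+1}, m_{n+1}) takes mediants
-- of the two, so bounds on the endpoints propagate to all later convergents.
module Submission where

open import Defs
open import Data.Nat.Base using (ℕ; _+_; _*_; _∸_; _≤_)
open import Data.Rational.Base using (0ℚ; 1ℚ)
open import Relation.Unary using (_∈_)

open import Data.Integer.Base using (+_)
import Data.Integer.Base as ℤ
import Data.Integer.Properties as ℤ
open import Data.Nat.Base using (zero; suc; pred; _<_; NonZero; >-nonZero; >-nonZero⁻¹; z≤n; s≤s)
open import Data.Nat.Coprimality using (Coprime; coprime⇒gcd≡1)
open import Data.Nat.Divisibility using (_∣_; ∣m⇒∣m*n; ∣n⇒∣m*n; ∣m+n∣m⇒∣n; ∣1⇒≡1)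
open import Data.Nat.Properties
open import Data.Nat.Tactic.RingSolver using (solve-∀)
open import Data.Product.Base using (_×_; _,_; proj₁; proj₂)
open import Data.Rational.Base as ℚ using (_/_)
import Data.Rational.Properties as ℚ
open import Data.Rational.Unnormalised.Base using (mkℚᵘ; *<*)
import Data.Rational.Unnormalised.Properties as ℚᵘ
open import Data.Sum.Base using (_⊎_; inj₁; inj₂)
open import Function.Base using (_∘_)
open import Function.Bundles using (_⇔_; mk⇔; Equivalence)
open import Relation.Binary.PropositionalEquality
open import Relation.Unary using (_⊆_)
open import Algebra.Properties.Group ℚ.+-0-group using (//-rightDividesˡ; ⁻¹-anti-homo-//)

open Equivalence using (to; from)

-- Comparison of fractions by cross-multiplication.

/-<-⇔ : ∀ a b c d .{{_ : NonZero b}} .{{_ : NonZero d}} →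
  (+ a / b) ℚ.< (+ c / d) ⇔ (a * d < c * b)
-- `_/_` reduces to lowest terms, so the comparison is moved to unnormalised rationals, where it
-- unfolds to cross-multiplication.
/-<-⇔ a b@(suc b-1) c d@(suc d-1) = mk⇔
  (λ r<s → cancel (ℚᵘ.drop-*<* (ℚᵘ.<-respˡ-≃ (ℚ.toℚᵘ-fromℚᵘ (mkℚᵘ (+ a) b-1))
     (ℚᵘ.<-respʳ-≃ (ℚ.toℚᵘ-fromℚᵘ (mkℚᵘ (+ c) d-1)) (ℚ.toℚᵘ-mono-< r<s)))))
  (λ lt → ℚ.toℚᵘ-cancel-< (ℚᵘ.<-respˡ-≃ (ℚᵘ.≃-sym (ℚ.toℚᵘ-fromℚᵘ (mkℚᵘ (+ a) b-1)))
     (ℚᵘ.<-respʳ-≃ (ℚᵘ.≃-sym (ℚ.toℚᵘ-fromℚᵘ (mkℚᵘ (+ c) d-1))) (*<* (embed lt)))))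
  where
  cancel : + a ℤ.* + d ℤ.< + c ℤ.* + b → a * d < c * b
  cancel = ℤ.drop‿+<+ ∘ subst₂ ℤ._<_ (sym (ℤ.pos-* a d)) (sym (ℤ.pos-* c b))
  embed : a * d < c * b → + a ℤ.* + d ℤ.< + c ℤ.* + b
  embed = subst₂ ℤ._<_ (ℤ.pos-* a d) (ℤ.pos-* c b) ∘ ℤ.+<+

/-≤-⇔ : ∀ a b c d .{{_ : NonZero b}} .{{_ : NonZero d}} →
  (+ a / b) ℚ.≤ (+ c / d) ⇔ (a * d ≤ c * b)
/-≤-⇔ a b c d = mk⇔
  (λ r≤s → ≮⇒≥ λ lt → ℚ.<-irrefl refl (ℚ.<-≤-trans (from (/-<-⇔ c d a b) lt) r≤s))
  (λ le → ℚ.≮⇒≥ λ lt → <⇒≱ (to (/-<-⇔ c d a b) lt) le)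

-- Fractions of determinant one and their mediants.

record Adjacent (a b c d : ℕ) : Set where
  constructor adjacent
  field determinant : c * b ≡ suc (a * d)

module _ {a b c d : ℕ} (adj : Adjacent a b c d) where

  open Adjacent adj

  -- A common divisor divides both `c * b` and `a * d`, which differ by one.
  adjacent-coprimeˡ : Coprime a b
  adjacent-coprimeˡ {i} (i∣a , i∣b) = ∣1⇒≡1 (∣m+n∣m⇒∣n
    (subst (i ∣_) (trans determinant (+-comm 1 (a * d))) (∣n⇒∣m*n c i∣b)) (∣m⇒∣m*n d i∣a))

  adjacent-coprimeʳ : Coprime c d
  adjacent-coprimeʳ {i} (i∣c , i∣d) = ∣1⇒≡1 (∣m+n∣m⇒∣n
    (subst (i ∣_) (trans determinant (+-comm 1 (a * d))) (∣m⇒∣m*n b i∣c)) (∣n⇒∣m*n a i∣d))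

  adjacent-mediantˡ : Adjacent a b (a + c) (b + d)
  adjacent-mediantˡ = adjacent (begin
    (a + c) * b          ≡⟨ *-distribʳ-+ b a c ⟩
    a * b + c * b        ≡⟨ cong (λ z → a * b + z) determinant ⟩
    a * b + suc (a * d)  ≡⟨ +-suc (a * b) (a * d) ⟩
    suc (a * b + a * d)  ≡⟨ cong suc (*-distribˡ-+ a b d) ⟨
    suc (a * (b + d))    ∎)
    where open ≡-Reasoning

  adjacent-mediantʳ : Adjacent (a + c) (b + d) c d
  adjacent-mediantʳ = adjacent (begin
    c * (b + d)          ≡⟨ *-distribˡ-+ c b d ⟩
    c * b + c * d        ≡⟨ cong (_+ c * d) determinant ⟩
    suc (a * d + c * d)  ≡⟨ cong suc (*-distribʳ-+ d a c) ⟨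
    suc ((a + c) * d)    ∎)
    where open ≡-Reasoning

  -- v = b (c v − d u) + d (u b − a v), where both brackets are positive.
  between-adjacent⇒denominator≥ : ∀ u v → a * v < u * b → u * d < c * v → b + d ≤ v
  between-adjacent⇒denominator≥ u v av<ub ud<cv =
    -- The subtracted terms of the identity are added to both sides to stay in `ℕ`.
    +-cancelˡ-≤ (b * (u * d) + d * (a * v)) (b + d) v (begin
      b * (u * d) + d * (a * v) + (b + d)      ≡⟨ regroup b (u * d) d (a * v) ⟩
      b * suc (u * d) + d * suc (a * v)        ≤⟨ +-mono-≤ (*-monoʳ-≤ b ud<cv) (*-monoʳ-≤ d av<ub) ⟩
      b * (c * v) + d * (u * b)                ≡⟨ cong (_+ d * (u * b)) (trans (pull b c v) (cong (_* v) determinant)) ⟩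
      suc (a * d) * v + d * (u * b)            ≡⟨ collect a b d u v ⟩
      b * (u * d) + d * (a * v) + v            ∎)
    where
    open ≤-Reasoning
    regroup : ∀ b x d y → b * x + d * y + (b + d) ≡ b * suc x + d * suc y
    regroup = solve-∀
    pull : ∀ b c v → b * (c * v) ≡ c * b * v
    pull = solve-∀
    collect : ∀ a b d u v → suc (a * d) * v + d * (u * b) ≡ b * (u * d) + d * (a * v) + v
    collect = solve-∀

  module _ {{b≢0 : NonZero b}} {{d≢0 : NonZero d}} where

    adjacent⇒< : (+ a / b) ℚ.< (+ c / d)
    adjacent⇒< = from (/-<-⇔ a b c d) (≤-reflexive (sym determinant))

    -- A Farey fraction strictly in between would need denominator at least `b + d`, more than
    -- `k + 1` allows.
    adjacent⇒consecutive : ∀ k → a ≤ b → c ≤ d → b ≤ k + 1 → d ≤ k + 1 → k + 1 < b + d →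
      Consecutive (FareyFraction k) (+ a / b) (+ c / d)
    adjacent⇒consecutive k a≤b c≤d b≤k+1 d≤k+1 k+1<b+d =
        (a , b , b≢0 , a≤b , b≤k+1 , coprime⇒gcd≡1 adjacent-coprimeˡ , refl)
      , (c , d , d≢0 , c≤d , d≤k+1 , coprime⇒gcd≡1 adjacent-coprimeʳ , refl)
      , adjacent⇒<
      , λ { _ (u , v , v≢0 , _ , v≤k+1 , _ , refl) (r<t , t<s) →
              <⇒≱ k+1<b+d (≤-trans
                (between-adjacent⇒denominator≥ u v
                  (to (/-<-⇔ a b u v {{b≢0}} {{v≢0}}) r<t)
                  (to (/-<-⇔ u v c d {{v≢0}}) t<s))
                v≤k+1) }

-- Taking the mediant with the left fraction `k` times keeps the determinant; this covers all but
-- the last unit of a partial quotient.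
adjacent-multipleˡ : ∀ {a b c d} → Adjacent a b c d → ∀ k → Adjacent a b (k * a + c) (k * b + d)
adjacent-multipleˡ                 adj zero    = adj
adjacent-multipleˡ {a} {b} {c} {d} adj (suc k) =
  subst₂ (Adjacent a b) (sym (+-assoc a (k * a) c)) (sym (+-assoc b (k * b) d))
    (adjacent-mediantˡ (adjacent-multipleˡ adj k))

adjacent-multipleʳ : ∀ {a b c d} → Adjacent a b c d → ∀ k → Adjacent (k * c + a) (k * d + b) c d
adjacent-multipleʳ                 adj zero    = adj
adjacent-multipleʳ {a} {b} {c} {d} adj (suc k) =
  subst₂ (λ s t → Adjacent s t c d) (regroup k c a) (regroup k d b)
    (adjacent-mediantʳ (adjacent-multipleʳ adj k))
  where
  regroup : ∀ k u u′ → k * u + u′ + u ≡ u + k * u + u′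
  regroup = solve-∀

-- The largest Farey depth whose cell contains a given cell with adjacent endpoints.

module _ {a b c d : ℕ} (adj : Adjacent a b c d)
         {{_ : NonZero b}} {{_ : NonZero d}}
         (a≤b : a ≤ b) (c≤d : c ≤ d) (x : ℝ) where

  -- For larger `k` the mediant is itself a Farey fraction. It lies in the cell, so inclusion would
  -- put it strictly between two consecutive Farey fractions.
  cell⊆fareyCell⇒≤ : ∀ k → ⟨ + a / b , + c / d ⟩ ⊆ fareyCell k x → k ≤ b + d ∸ 2
  cell⊆fareyCell⇒≤ k cell⊆ = ≮⇒≥ λ N<k →
    let instance
          b+d≢0 : NonZero (b + d)
          b+d≢0 = >-nonZero (≤-trans (>-nonZero⁻¹ b) (m≤m+n b d))
        m = + (a + c) / (b + d)
        b+d≤k+1 = ≤-trans (m≤n+m∸n (b + d) 2)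
                    (≤-trans (s≤s N<k) (≤-reflexive (+-comm 1 k)))
        r , s , (_ , _ , _ , empty) , _ , r<m , m<s =
          cell⊆ {fromℚ m} (adjacent⇒< (adjacent-mediantˡ adj) , adjacent⇒< (adjacent-mediantʳ adj))
    in empty m
         (a + c , b + d , b+d≢0 , +-mono-≤ a≤b c≤d , b+d≤k+1
           , coprime⇒gcd≡1 (adjacent-coprimeʳ (adjacent-mediantˡ adj)) , refl)
         (r<m , m<s)

  cell⊆fareyCell : x ∈ ⟨ + a / b , + c / d ⟩ →
    ⟨ + a / b , + c / d ⟩ ⊆ fareyCell (b + d ∸ 2) x
  cell⊆fareyCell x∈ y∈ = _ , _ ,
    adjacent⇒consecutive adj (b + d ∸ 2) a≤b c≤d
      (subst (b ≤_) (sym N+1) (<⇒≤pred (m<m+n b (>-nonZero⁻¹ d))))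
      (subst (d ≤_) (sym N+1) (<⇒≤pred (m<n+m d (>-nonZero⁻¹ b))))
      (≤-reflexive (trans (cong suc N+1) (suc-pred (b + d) {{>-nonZero (≤-trans (s≤s z≤n) 2≤b+d)}})))
    , x∈ , y∈
    where
    -- Both denominators are positive, so the truncated `∸ 2` loses nothing.
    2≤b+d : 2 ≤ b + d
    2≤b+d = +-mono-≤ (>-nonZero⁻¹ b) (>-nonZero⁻¹ d)
    N+1 : b + d ∸ 2 + 1 ≡ pred (b + d)
    N+1 = trans (+-comm (b + d ∸ 2) 1) (sym (+-∸-assoc 1 2≤b+d))

  adjacent⇒sup : x ∈ ⟨ + a / b , + c / d ⟩ →
    IsSup (λ k → ⟨ + a / b , + c / d ⟩ ⊆ fareyCell k x) (b + d ∸ 2)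
  adjacent⇒sup x∈ = cell⊆fareyCell⇒≤ , λ M bound → bound (b + d ∸ 2) λ {y} → cell⊆fareyCell x∈ {y}

-- Half-planes of numerator-denominator pairs, closed under addition.

record Cone : Set₁ where
  field
    weak strict   : (u v : ℕ) → Set
    strict⇒weak   : ∀ {u v} → strict u v → weak u v
    weak+weak     : ∀ {u v s t} → weak u v → weak s t → weak (u + s) (v + t)
    weak+strict   : ∀ {u v s t} → weak u v → strict s t → strict (u + s) (v + t)

  strict+weak : ∀ {u v s t} → strict u v → weak s t → strict (u + s) (v + t)
  strict+weak {u} {v} {s} {t} h k = subst₂ strict (+-comm s u) (+-comm t v) (weak+strict k h)

  weak*+weak : ∀ k {u v s t} → weak u v → weak s t → weak (k * u + s) (k * v + t)
  weak*+weak zero            _ w = w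
  weak*+weak (suc k) {u} {v} h w = subst₂ weak (sym (+-assoc u _ _)) (sym (+-assoc v _ _))
    (weak+weak h (weak*+weak k h w))

  weak*+strict : ∀ k {u v s t} → weak u v → strict s t → strict (k * u + s) (k * v + t)
  weak*+strict zero            _ w = w
  weak*+strict (suc k) {u} {v} h w = subst₂ strict (sym (+-assoc u _ _)) (sym (+-assoc v _ _))
    (weak+strict h (weak*+strict k h w))

open Cone

-- Pairs `s`, `t` with `u / v` as a lower bound of `s / t`. The condition is linear in the pair, so
-- sums inherit it, and a single strict summand makes the sum strict.
above : (u v : ℕ) → Cone
above u v = record
  { weak        = λ s t → u * t ≤ s * v
  ; strict      = λ s t → u * t < s * v
  ; strict⇒weak = <⇒≤
  ; weak+weak   = λ {s} {t} {s′} {t′} h k →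
      subst₂ _≤_ (sym (*-distribˡ-+ u t t′)) (sym (*-distribʳ-+ v s s′)) (+-mono-≤ h k)
  ; weak+strict = λ {s} {t} {s′} {t′} h k →
      subst₂ _<_ (sym (*-distribˡ-+ u t t′)) (sym (*-distribʳ-+ v s s′)) (+-mono-≤-< h k)
  }

below : (u v : ℕ) → Cone
below u v = record
  { weak        = λ s t → s * v ≤ u * t
  ; strict      = λ s t → s * v < u * t
  ; strict⇒weak = <⇒≤
  ; weak+weak   = λ {s} {t} {s′} {t′} h k →
      subst₂ _≤_ (sym (*-distribʳ-+ v s s′)) (sym (*-distribˡ-+ u t t′)) (+-mono-≤ h k)
  ; weak+strict = λ {s} {t} {s′} {t′} h k →
      subst₂ _<_ (sym (*-distribʳ-+ v s s′)) (sym (*-distribˡ-+ u t t′)) (+-mono-≤-< h k)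
  }

-- Monotonicity of cuts, and differences of rationals.

module _ (x : ℝ) where

  -- Roundedness only descends strictly, so a point `t` between `s` and `x` is chosen first.
  lower-downward : ∀ {r s} → r ℚ.≤ s → lower x s → lower x r
  lower-downward {r} {s} r≤s s<x =
    let t , s<t , t<x = to (lower-rounded x s) s<x
    in from (lower-rounded x r) (t , ℚ.≤-<-trans r≤s s<t , t<x)

  upper-upward : ∀ {r s} → r ℚ.≤ s → upper x r → upper x s
  upper-upward {r} {s} r≤s x<r =
    let t , t<r , x<t = to (upper-rounded x r) x<r
    in from (upper-rounded x s) (t , ℚ.<-≤-trans t<r r≤s , x<t)

r<s⇒0<s-r : ∀ {r s} → r ℚ.< s → 0ℚ ℚ.< s ℚ.- r
r<s⇒0<s-r {r} {s} r<s = subst (ℚ._< s ℚ.- r) (ℚ.+-inverseʳ r) (ℚ.+-monoˡ-< (ℚ.- r) r<s)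

r+[s-r]≡s : ∀ r s → r ℚ.+ (s ℚ.- r) ≡ s
r+[s-r]≡s r s = trans (ℚ.+-comm r (s ℚ.- r)) (//-rightDividesˡ r s)

s-[s-r]≡r : ∀ r s → s ℚ.- (s ℚ.- r) ≡ r
s-[s-r]≡r r s = trans (cong (s ℚ.+_) (⁻¹-anti-homo-// s r)) (r+[s-r]≡s s r)

-- The passage from one continued fraction cell to the next.

module _ (a : PartialQuotients) where

  pMed qMed : ℕ → ℕ
  pMed n = p a n + pPrev a n
  qMed n = q a n + qPrev a n

  -- k is a_{n+1} − 1
  cell-step : (P : (u v s t : ℕ) → Set) → ∀ n →
    (∀ k → let u = k * p a n + pMed n; v = k * q a n + qMed n in P u v (u + p a n) (v + q a n)) →
    P (p a (suc n)) (q a (suc n)) (pMed (suc n)) (qMed (suc n))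
  cell-step P n h with term a (suc n) | positive a n
  -- The new convergent is `k` copies of the old one plus the old mediant; the new mediant adds one
  -- more copy.
  ... | suc k | _ = subst₂ (λ u v → P u v (u + p a n) (v + q a n))
                      (regroup k (p a n) (pPrev a n)) (regroup k (q a n) (qPrev a n)) (h k)
    where
    regroup : ∀ k u u′ → k * u + (u + u′) ≡ u + k * u + u′
    regroup = solve-∀

  p≤q×pMed≤qMed : ∀ n → p a n ≤ q a n × pMed n ≤ qMed n
  p≤q×pMed≤qMed zero    = z≤n , ≤-refl
  p≤q×pMed≤qMed (suc n) =
    let p≤q , pMed≤qMed = p≤q×pMed≤qMed n
    in cell-step (λ u v s t → u ≤ v × s ≤ t) n λ k →
         let u≤v = +-mono-≤ (*-monoʳ-≤ k p≤q) pMed≤qMed in u≤v , +-mono-≤ u≤v p≤q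

  -- The new convergent comes from moving the old mediant towards the old convergent, and the new
  -- mediant goes one step further the same way, so the two sides swap.
  orientation : ∀ n → Adjacent (p a n) (q a n) (pMed n) (qMed n)
                    ⊎ Adjacent (pMed n) (qMed n) (p a n) (q a n)
  orientation zero    = inj₁ (adjacent refl)
  orientation (suc n) with orientation n
  ... | inj₁ adj = inj₂ (cell-step (λ u v s t → Adjacent s t u v) n λ k →
          subst₂ (λ s t → Adjacent s t (k * p a n + pMed n) (k * q a n + qMed n))
            (+-comm (p a n) _) (+-comm (q a n) _) (adjacent-mediantʳ (adjacent-multipleˡ adj k)))
  ... | inj₂ adj = inj₁ (cell-step Adjacent n λ k → adjacent-mediantˡ (adjacent-multipleʳ adj k))

  module _ (C : Cone) where

    weak-step : ∀ n → weak C (p a n) (q a n) × weak C (pMed n) (qMed n) →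
      weak C (p a (suc n)) (q a (suc n)) × weak C (pMed (suc n)) (qMed (suc n))
    weak-step n (h , h′) = cell-step (λ u v s t → weak C u v × weak C s t) n λ k →
      let w = weak*+weak C k h h′ in w , weak+weak C w h

    weak-steps : ∀ n → weak C (p a n) (q a n) × weak C (pMed n) (qMed n) →
      ∀ k → weak C (p a (k + n)) (q a (k + n)) × weak C (pMed (k + n)) (qMed (k + n))
    weak-steps n h zero    = h
    weak-steps n h (suc k) = weak-step (k + n) (weak-steps n h k)

    -- The old mediant is a summand of both new pairs, so its strictness reaches both at once.
    strict-step : ∀ n → weak C (p a n) (q a n) → strict C (pMed n) (qMed n) →
      strict C (p a (suc n)) (q a (suc n)) × strict C (pMed (suc n)) (qMed (suc n))
    strict-step n h h′ = cell-step (λ u v s t → strict C u v × strict C s t) n λ k →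
      let w = weak*+strict C k h h′ in w , strict+weak C w h

    -- If the partial quotient is 1, the new convergent is just the old mediant and may be only
    -- weakly bounded. The new mediant is always strict, so a second step suffices.
    strict-step₂ : ∀ n → strict C (p a n) (q a n) → weak C (pMed n) (qMed n) →
      strict C (p a (2 + n)) (q a (2 + n)) × strict C (pMed (2 + n)) (qMed (2 + n))
    strict-step₂ n h h′ =
      let w , s = cell-step (λ u v s t → weak C u v × strict C s t) n λ k →
                    let w = weak*+weak C k (strict⇒weak C h) h′ in w , weak+strict C w h
      in strict-step (suc n) w s

  -- Locating the limit strictly inside each cell.

  module _ {x : ℝ} (x≐a : x ≐[0⸴ a ]) where

    -- Convergence with tolerance `l - r` puts `x` above a late convergent minus `l - r`, which is
    -- at least `r`.
    limit-lower : ∀ u v s t .{{_ : NonZero t}} .{{_ : NonZero v}} n → u * t < s * v →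
      (∀ k → s * q a (k + n) ≤ p a (k + n) * t) → lower x (+ u / v)
    limit-lower u v s t n r<l l≤c =
      let r = + u / v
          l = + s / t
          N , near = x≐a (l ℚ.- r) (r<s⇒0<s-r (from (/-<-⇔ u v s t) r<l))
          instance _ = q-nonZero a (N + n)
      in lower-downward x
           (subst (ℚ._≤ convergent a (N + n) ℚ.- (l ℚ.- r)) (s-[s-r]≡r r l)
             (ℚ.+-monoˡ-≤ (ℚ.- (l ℚ.- r)) (from (/-≤-⇔ s t (p a (N + n)) (q a (N + n))) (l≤c N))))
           (proj₁ (near (N + n) (m≤m+n N n)))

    limit-upper : ∀ u v s t .{{_ : NonZero t}} .{{_ : NonZero v}} n → s * v < u * t →
      (∀ k → p a (k + n) * t ≤ s * q a (k + n)) → upper x (+ u / v)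
    limit-upper u v s t n h<r c≤h =
      let r = + u / v
          h = + s / t
          N , near = x≐a (r ℚ.- h) (r<s⇒0<s-r (from (/-<-⇔ s t u v) h<r))
          instance _ = q-nonZero a (N + n)
      in upper-upward x
           (subst (convergent a (N + n) ℚ.+ (r ℚ.- h) ℚ.≤_) (r+[s-r]≡s h r)
             (ℚ.+-monoˡ-≤ (r ℚ.- h) (from (/-≤-⇔ (p a (N + n)) (q a (N + n)) s t) (c≤h N))))
           (proj₂ (near (N + n) (m≤m+n N n)))

    -- Strictness must survive the limit: the smaller endpoint bounds all later convergents weakly
    -- and leaves a fixed gap above `u / v`.
    strict-lower : ∀ u v .{{_ : NonZero v}} n →
      strict (above u v) (p a n) (q a n) × strict (above u v) (pMed n) (qMed n) →
      lower x (+ u / v)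
    strict-lower u v n (r<c , r<m) with ≤-total (p a n * qMed n) (pMed n * q a n)
    ... | inj₁ c≤m = limit-lower u v (p a n) (q a n) {{q-nonZero a n}} n r<c
                       (proj₁ ∘ weak-steps (above (p a n) (q a n)) n (≤-refl , c≤m))
    ... | inj₂ m≤c = limit-lower u v (pMed n) (qMed n) {{q+qPrev-nonZero a n}} n r<m
                       (proj₁ ∘ weak-steps (above (pMed n) (qMed n)) n (m≤c , ≤-refl))

    strict-upper : ∀ u v .{{_ : NonZero v}} n →
      strict (below u v) (p a n) (q a n) × strict (below u v) (pMed n) (qMed n) →
      upper x (+ u / v)
    strict-upper u v n (c<r , m<r) with ≤-total (p a n * qMed n) (pMed n * q a n)
    ... | inj₁ c≤m = limit-upper u v (pMed n) (qMed n) {{q+qPrev-nonZero a n}} n m<r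
                       (proj₁ ∘ weak-steps (below (pMed n) (qMed n)) n (c≤m , ≤-refl))
    ... | inj₂ m≤c = limit-upper u v (p a n) (q a n) {{q-nonZero a n}} n c<r
                       (proj₁ ∘ weak-steps (below (p a n) (q a n)) n (≤-refl , m≤c))

    module _ (n : ℕ) where

      private instance
        q≢0 : NonZero (q a n)
        q≢0 = q-nonZero a n
        qMed≢0 : NonZero (qMed n)
        qMed≢0 = q+qPrev-nonZero a n

      cfCell-sup : IsSup (λ k → cfCell a n ⊆ fareyCell k x) (2 * q a n + qPrev a n ∸ 2)
      cfCell-sup with orientation n | p≤q×pMed≤qMed n
      ... | inj₁ adj@(adjacent det) | p≤q , pMed≤qMed =
        subst₂ (λ l h → IsSup (λ k → ⟨ l , h ⟩ ⊆ fareyCell k x) (2 * q a n + qPrev a n ∸ 2))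
          (sym (ℚ.p≤q⇒p⊓q≡p c≤m)) (sym (ℚ.p≤q⇒p⊔q≡q c≤m))
          (subst (IsSup _) (cong (_∸ 2) (denominators (q a n) (qPrev a n)))
            (adjacent⇒sup adj p≤q pMed≤qMed x
              -- The mediant already lies strictly beyond the convergent, so that bound needs one
              -- step; the bound by the mediant needs two.
              ( strict-lower (p a n) (q a n) (suc n)
                  (strict-step (above (p a n) (q a n)) n ≤-refl c<m)
              , strict-upper (pMed n) (qMed n) (2 + n)
                  (strict-step₂ (below (pMed n) (qMed n)) n c<m ≤-refl))))
        where
        c<m : p a n * qMed n < pMed n * q a n
        c<m = ≤-reflexive (sym det)
        c≤m : convergent a n ℚ.≤ mediant a n
        c≤m = ℚ.<⇒≤ (adjacent⇒< adj)
        denominators : ∀ v v′ → v + (v + v′) ≡ 2 * v + v′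
        denominators = solve-∀
      ... | inj₂ adj@(adjacent det) | p≤q , pMed≤qMed =
        subst₂ (λ l h → IsSup (λ k → ⟨ l , h ⟩ ⊆ fareyCell k x) (2 * q a n + qPrev a n ∸ 2))
          (sym (ℚ.p≥q⇒p⊓q≡q m≤c)) (sym (ℚ.p≥q⇒p⊔q≡p m≤c))
          (subst (IsSup _) (cong (_∸ 2) (denominators (q a n) (qPrev a n)))
            (adjacent⇒sup adj pMed≤qMed p≤q x
              ( strict-lower (pMed n) (qMed n) (2 + n)
                  (strict-step₂ (above (pMed n) (qMed n)) n m<c ≤-refl)
              , strict-upper (p a n) (q a n) (suc n)
                  (strict-step (below (p a n) (q a n)) n ≤-refl m<c))))
        where
        m<c : pMed n * q a n < p a n * qMed n
        m<c = ≤-reflexive (sym det)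
        m≤c : mediant a n ℚ.≤ convergent a n
        m≤c = ℚ.<⇒≤ (adjacent⇒< adj)
        denominators : ∀ v v′ → v + v′ + v ≡ 2 * v + v′
        denominators = solve-∀

proposition5p3 : (x : ℝ) → x ∈ ⟨ 0ℚ , 1ℚ ⟩ → Irrational x →
    (a : PartialQuotients) → x ≐[0⸴ a ] →
    (n : ℕ) → 1 ≤ n →
    IsLochsIndex (cfCell a) (λ k → fareyCell k x) n (2 * q a n + q a (n ∸ 1) ∸ 2)
-- With the depth a successor, `q a (n ∸ 1)` is `qPrev` at that depth by computation.
proposition5p3 x _ _ a x≐a (suc n) _ = cfCell-sup a {x} x≐a (suc n)
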